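{- Let $G$ be a graph of girth at least $7$. Then $\mathrm{b}^{\ast}(G)=m^{\ast}(G)+1$.
   Context: All graphs are finite, nonempty, undirected, without loops or multiple edges. The girth of a graph is the length of its shortest cycle (an acyclic graph has girth $\infty$). A proper vertex coloring of $G$ with $k$ colors is a surjective map $c:V(G)\to\{1,\dots,k\}$ with $c(x)\neq c(y)$ for every edge $xy$. In such a coloring, a vertex $v$ is a b-vertex if for every color $j\neq c(v)$ among the $k$ colors, $v$ has a neighbor of color $j$. A vertex $u$ is nice if for every color $j\neq c(u)$, $u$ has a neighbor of color $j$ that is a b-vertex. A $\mathrm{b}^{\ast}$-coloring of $G$ is a proper coloring that has a nice vertex. $\mathrm{b}^{\ast}(G)$ is the maximum number of colors used in a $\mathrm{b}^{\ast}$-coloring of $G$. $m^{\ast}(G)$ is the largest integer $k\ge 0$ such that some vertex of degree at least $k$ in $G$ has at least $k$ neighbors each of degree at least $k$ in $G$. -}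

module Defs where

open import Data.Empty using (⊥)
open import Data.Fin using (Fin)
open import Data.List using (List; []; _∷_; _∷ʳ_; length; filter; allFin)
open import Data.List.Relation.Unary.Linked using (Linked)
open import Data.List.Relation.Unary.Unique.Propositional using (Unique)
open import Data.Nat using (ℕ; _≤_; _≤?_; NonZero)
open import Data.Product using (∃; ∃-syntax; _×_)
open import Function.Definitions using (StrictlySurjective)
open import Relation.Binary.Core using (Rel)
open import Relation.Binary.Definitions using (Decidable; Symmetric; Irreflexive)
open import Relation.Binary.PropositionalEquality using (_≡_; _≢_)
open import Relation.Nullary using (¬_; _×-dec_)
open import Relation.Nullary.Construct.Add.Supremum using (_⁺; [_]; ⊤⁺)
open import Level using (0ℓ)
import Relation.Unary as U

-- Adjacency is decidable because a finite graph is a finite piece of data;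
-- degrees are computed from it.
record Graph : Set₁ where
  field
    order   : ℕ
    nonZero : NonZero order

  V : Set
  V = Fin order

  field
    Adj    : Rel V 0ℓ
    adj?   : Decidable Adj
    sym    : Symmetric Adj
    irrefl : Irreflexive _≡_ Adj

-- A maximum is unique but need not exist, so quantities defined as maxima are
-- given as relations; likewise for minima.
IsMaximum : (ℕ → Set) → ℕ → Set
IsMaximum P m = P m × (∀ k → P k → k ≤ m)

IsMinimum : (ℕ → Set) → ℕ → Set
IsMinimum P m = P m × (∀ k → P k → m ≤ k)

module _ (G : Graph) where
  open Graph G

  #_ : {P : V → Set} → U.Decidable P → ℕ
  # P? = length (filter P? (allFin order))

  degree : V → ℕ
  degree v = # (adj? v)

  -- The vertices of a cycle are listed once each, in cyclic order.
  IsCycle : List V → Set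
  IsCycle []       = ⊥
  IsCycle (x ∷ xs) =
    3 ≤ length (x ∷ xs) × Unique (x ∷ xs) × Linked Adj (x ∷ xs ∷ʳ x)

  HasCycleOfLength : ℕ → Set
  HasCycleOfLength ℓ = ∃[ vs ] IsCycle vs × length vs ≡ ℓ

  -- ⊤⁺ plays the role of ∞.
  IsGirth : ℕ ⁺ → Set
  IsGirth [ g ] = IsMinimum HasCycleOfLength g
  IsGirth ⊤⁺    = ∀ ℓ → ¬ HasCycleOfLength ℓ

  record ProperColoring (k : ℕ) : Set where
    field
      color      : V → Fin k
      surjective : StrictlySurjective _≡_ color
      proper     : ∀ {x y} → Adj x y → color x ≢ color y

    IsBVertex : V → Set
    IsBVertex v = ∀ j → j ≢ color v → ∃[ w ] Adj v w × color w ≡ j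

    IsNice : V → Set
    IsNice u = ∀ j → j ≢ color u → ∃[ w ] Adj u w × color w ≡ j × IsBVertex w

    IsB⋆Coloring : Set
    IsB⋆Coloring = ∃ IsNice

  HasB⋆Coloring : ℕ → Set
  HasB⋆Coloring k = ∃[ c ] ProperColoring.IsB⋆Coloring {k} c

  -- b⋆(G) = b
  IsB⋆ : ℕ → Set
  IsB⋆ = IsMaximum HasB⋆Coloring

  M⋆Condition : ℕ → Set
  M⋆Condition k =
    ∃[ v ] k ≤ degree v × k ≤ # (λ w → adj? v w ×-dec k ≤? degree w)

  -- m⋆(G) = m
  IsM⋆ : ℕ → Set
  IsM⋆ = IsMaximum M⋆Condition

{-# OPTIONS --safe #-}

-- Let m = m⋆(G).  The nice vertex of a b⋆-coloring with k + 1 colors witnesses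
-- M⋆Condition k, so b⋆ ≤ m + 1.
--
-- Conversely, take a vertex v with m neighbours wᵢ of degree ≥ m and precolor the
-- skeleton S consisting of v, the wᵢ and m − 1 further neighbours of each wᵢ so
-- that v is nice.  Girth ≥ 7 makes this proper and leaves every vertex outside S
-- with at most one neighbour in S.  Call a vertex heavy if its degree exceeds m;
-- by maximality of m no vertex has more than m heavy neighbours.  Call a heavy
-- vertex saturated if it has m heavy neighbours.  Coloring greedily first the
-- saturated, then the other heavy, then the remaining vertices uses m + 1 colors:
-- * if every saturated vertex has an unsaturated heavy neighbour, it sees at most
--   m − 1 saturated vertices and one of S when its turn comes, while an
--   unsaturated heavy vertex sees at most m − 1 heavy vertices and one of S;
-- * otherwise some saturated vertex has only saturated heavy neighbours, and S can
--   be chosen around it among the heavy vertices, of which nobody sees more than m.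

module Submission where

open import Defs
open import Data.Empty using (⊥; ⊥-elim)
open import Data.Fin using (Fin; zero; suc; inject≤; punchIn)
open import Data.Fin.Permutation.Components using (transpose; transpose-inverse)
open import Data.Fin.Properties
  using (_≟_; any?; ¬∀⟶∃¬; injective⇒≤; inject≤-injective; suc-injective;
         punchIn-injective; punchInᵢ≢i)
open import Data.List using (List; []; _∷_; _++_; _∷ʳ_; length; filter; allFin; map; lookup)
open import Data.List.Membership.Propositional using (_∈_; _∉_)
open import Data.List.Membership.Propositional.Properties
  using (∈-filter⁺; ∈-filter⁻; ∈-allFin; ∈-lookup; ∈-map⁺; ∈-∃++; ∈-insert)
import Data.List.Membership.DecPropositional as DecMembership
open import Data.List.Membership.Setoid.Properties using (index-injective)
open import Data.List.Properties using (length-map; length-filter; length-tabulate; length-++)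
open import Data.List.Relation.Unary.All using ([]; _∷_)
import Data.List.Relation.Unary.All as All
open import Data.List.Relation.Unary.All.Properties using (++⁻ˡ; ¬Any⇒All¬)
open import Data.List.Relation.Unary.AllPairs using ([]; _∷_)
open import Data.List.Relation.Unary.Any using (here; there; index)
open import Data.List.Relation.Unary.Linked using (Linked; [-]; _∷_)
import Data.List.Relation.Unary.Linked as Linked
open import Data.List.Relation.Unary.Unique.Propositional using (Unique)
open import Data.List.Relation.Unary.Unique.Propositional.Properties
  using (allFin⁺; filter⁺; Unique[x∷xs]⇒x∉xs)
open import Data.Nat using (ℕ; zero; suc; _+_; _≤_; _<_; _≤?_; z≤n; s≤s; s≤s⁻¹; NonZero)
open import Data.Nat.Properties
  using (≤-refl; ≤-trans; ≤-reflexive; m≤m+n; +-comm; +-mono-≤; n≤1+n; <⇒≱; ≰⇒>;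
         ≮⇒≥; +-monoʳ-≤; +-suc; m≤n⇒m<n∨m≡n; module ≤-Reasoning)
open import Data.Product using (∃; ∃-syntax; _×_; _,_; proj₁; proj₂)
open import Data.Sum using (_⊎_; inj₁; inj₂)
import Data.Sum as Sum
open import Data.Unit using (⊤; tt)
open import Function using (_∘_; id)
open import Function.Definitions using (Injective)
open import Level using (0ℓ)
open import Relation.Binary.PropositionalEquality
  using (_≡_; _≢_; refl; sym; trans; cong; subst; setoid)
open import Relation.Nullary using (¬_; Dec; yes; no; ¬?; _×-dec_; contradiction)
open import Relation.Nullary.Decidable using (True; toWitness; decidable-stable; dec-true)
open import Relation.Unary using (Pred; Decidable; U; _∪_; _⊆_)
open import Relation.Unary.Properties using (U?; _∪?_)
open import Relation.Nullary.Construct.Add.Supremum using (_⁺; [_]; ⊤⁺)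
open import Relation.Binary.Construct.Add.Supremum.NonStrict _≤_ using (_≤⁺_; [_]; _≤⊤⁺)

-- Counting and enumerating subsets of a finite set.

lookup-injective : ∀ {A : Set} {xs : List A} → Unique xs →
  Injective _≡_ _≡_ (lookup xs)
lookup-injective (_ ∷ _) {zero} {zero} _ = refl
lookup-injective (x∉ ∷ _) {zero} {suc j} eq = contradiction eq (All.lookup x∉ (∈-lookup j))
lookup-injective (x∉ ∷ _) {suc i} {zero} eq = contradiction (sym eq) (All.lookup x∉ (∈-lookup i))
lookup-injective (_ ∷ u) {suc i} {suc j} eq = cong suc (lookup-injective u eq)

length-filter-∪ : ∀ {A : Set} {P Q : Pred A 0ℓ} (P? : Decidable P) (Q? : Decidable Q) xs →
  length (filter (P? ∪? Q?) xs) ≤ length (filter P? xs) + length (filter Q? xs)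
length-filter-∪ P? Q? [] = z≤n
length-filter-∪ P? Q? (x ∷ xs) with ih ← length-filter-∪ P? Q? xs | P? x | Q? x
... | yes _ | yes _ = s≤s (≤-trans ih (+-monoʳ-≤ _ (n≤1+n _)))
... | yes _ | no _  = s≤s ih
... | no _  | yes _ = ≤-trans (s≤s ih) (≤-reflexive (sym (+-suc _ _)))
... | no _  | no _  = ih

module _ {n : ℕ} where

  count : {P : Pred (Fin n) 0ℓ} → Decidable P → ℕ
  count P? = length (filter P? (allFin n))

  enumerate : ∀ {P : Pred (Fin n) 0ℓ} (P? : Decidable P) {k} → k ≤ count P? →
    ∃[ f ] Injective _≡_ _≡_ f × (∀ (i : Fin k) → P (f i))
  enumerate P? k≤ =
    (λ i → lookup (filter P? (allFin n)) (inject≤ i k≤)) ,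
    (λ eq → inject≤-injective _ _ _ _ (lookup-injective (filter⁺ P? (allFin⁺ n)) eq)) ,
    (λ i → proj₂ (∈-filter⁻ P? {xs = allFin n} (∈-lookup (inject≤ i k≤))))

  injective⇒≤count : ∀ {P : Pred (Fin n) 0ℓ} (P? : Decidable P) {k} {f : Fin k → Fin n} →
    Injective _≡_ _≡_ f → (∀ i → P (f i)) → k ≤ count P?
  injective⇒≤count P? {f = f} f-inj Pf = injective⇒≤ {f = index ∘ f∈}
    (f-inj ∘ index-injective (setoid _) (f∈ _) (f∈ _))
    where
    f∈ : ∀ i → f i ∈ filter P? (allFin n)
    f∈ i = ∈-filter⁺ P? (∈-allFin (f i)) (Pf i)

  count-mono : ∀ {P Q : Pred (Fin n) 0ℓ} (P? : Decidable P) (Q? : Decidable Q) →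
    P ⊆ Q → count P? ≤ count Q?
  count-mono P? Q? P⊆Q with f , f-inj , Pf ← enumerate P? ≤-refl =
    injective⇒≤count Q? f-inj (P⊆Q ∘ Pf)

  count-mono-< : ∀ {P Q : Pred (Fin n) 0ℓ} (P? : Decidable P) (Q? : Decidable Q) →
    P ⊆ Q → ∀ {y} → Q y → ¬ P y → count P? < count Q?
  count-mono-< {P} {Q} P? Q? P⊆Q {y} Qy ¬Py with f , f-inj , Pf ← enumerate P? ≤-refl =
    injective⇒≤count Q? {f = g} g-inj Qg
    where
    g : Fin (suc (count P?)) → Fin n
    g zero    = y
    g (suc i) = f i
    g-inj : Injective _≡_ _≡_ g
    g-inj {zero}  {zero}  _  = refl
    g-inj {zero}  {suc j} eq = contradiction (subst P (sym eq) (Pf j)) ¬Py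
    g-inj {suc i} {zero}  eq = contradiction (subst P eq (Pf i)) ¬Py
    g-inj {suc i} {suc j} eq = cong suc (f-inj eq)
    Qg : ∀ i → Q (g i)
    Qg zero    = Qy
    Qg (suc i) = P⊆Q (Pf i)

  count≤1 : ∀ {P : Pred (Fin n) 0ℓ} (P? : Decidable P) →
    (∀ {x y} → P x → P y → x ≡ y) → count P? ≤ 1
  count≤1 P? unique = ≮⇒≥ λ 1<count →
    let f , f-inj , Pf = enumerate P? 1<count in
    contradiction (f-inj (unique (Pf zero) (Pf (suc zero)))) λ ()

  -- If an enumeration hits `v`, a transposition moves `v` to index `i`; otherwise the entry at `i`
  -- is overwritten. This puts the root at `x i i` in a skeleton.
  enumerate-through : ∀ {P : Pred (Fin n) 0ℓ} (P? : Decidable P) {k} → k ≤ count P? →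
    ∀ {v} → P v → (i : Fin k) →
    ∃[ f ] Injective _≡_ _≡_ f × (∀ (j : Fin k) → P (f j)) × f i ≡ v
  enumerate-through {P} P? {k} k≤ {v} Pv i with enumerate P? k≤
  ... | f , f-inj , Pf with any? (λ j → f j ≟ v)
  ... | yes (j , fj≡v) =
    f ∘ transpose i j ,
    (λ eq → trans (sym (transpose-inverse j i))
              (trans (cong (transpose j i) (f-inj eq)) (transpose-inverse j i))) ,
    Pf ∘ transpose i j ,
    trans (cong f transpose-i) fj≡v
    where
    transpose-i : transpose i j i ≡ j
    transpose-i rewrite dec-true (i ≟ i) refl = refl
  ... | no v∉f = g , g-inj , Pg , g-i
    where
    g : Fin k → Fin n
    g j with j ≟ i
    ... | yes _ = v
    ... | no  _ = f j
    g-inj : Injective _≡_ _≡_ g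
    g-inj {a} {b} eq with a ≟ i | b ≟ i
    ... | yes a≡i | yes b≡i = trans a≡i (sym b≡i)
    ... | yes _   | no _    = contradiction (b , sym eq) v∉f
    ... | no _    | yes _   = contradiction (a , eq) v∉f
    ... | no _    | no _    = f-inj eq
    Pg : ∀ j → P (g j)
    Pg j with j ≟ i
    ... | yes _ = Pv
    ... | no  _ = Pf j
    g-i : g i ≡ v
    g-i with i ≟ i
    ... | yes _  = refl
    ... | no i≢i = contradiction refl i≢i

  count≤n : ∀ {P : Pred (Fin n) 0ℓ} (P? : Decidable P) → count P? ≤ n
  count≤n P? = ≤-trans (length-filter P? (allFin n)) (≤-reflexive (length-tabulate id))

∃∉ : ∀ {k} (xs : List (Fin k)) → length xs < k → ∃[ a ] a ∉ xs
∃∉ {k} xs short = ¬∀⟶∃¬ k (_∈ xs) (_∈? xs) λ all∈ →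
  <⇒≱ short (injective⇒≤ {f = index ∘ all∈} (index-injective (setoid _) (all∈ _) (all∈ _)))
  where open DecMembership _≟_ using (_∈?_)

bounded⇒maximum : {P : ℕ → Set} → (∀ k → Dec (P k)) → P 0 →
  ∀ n → (∀ k → P k → k ≤ n) → ∃ (IsMaximum P)
bounded⇒maximum P? P0 zero    bound = 0 , P0 , bound
bounded⇒maximum {P} P? P0 (suc n) bound with P? (suc n)
... | yes Pn = suc n , Pn , bound
... | no ¬Pn = bounded⇒maximum P? P0 n λ k Pk → case-≤ k Pk (m≤n⇒m<n∨m≡n (bound k Pk))
  where
  case-≤ : ∀ k → P k → k < suc n ⊎ k ≡ suc n → k ≤ n
  case-≤ k Pk (inj₁ k<) = s≤s⁻¹ k<
  case-≤ k Pk (inj₂ refl) = contradiction Pk ¬Pn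

-- Non-backtracking walks and short cycles.

unique-rotate : ∀ {A : Set} {x : A} ys {zs} → Unique (ys ++ x ∷ zs) → Unique (x ∷ ys)
unique-rotate []       _          = [] ∷ []
unique-rotate (y ∷ ys) (y∉ ∷ u) with x∉ys ∷ uys ← unique-rotate ys u =
  ((λ x≡y → All.lookup y∉ (∈-insert ys) (sym x≡y)) ∷ x∉ys) ∷ (++⁻ˡ ys y∉ ∷ uys)

linked-prefix : ∀ {A : Set} {R : A → A → Set} {x : A} ys {zs} →
  Linked R (ys ++ x ∷ zs) → Linked R (ys ∷ʳ x)
linked-prefix []            _       = [-]
linked-prefix (_ ∷ [])      (r ∷ _) = r ∷ [-]
linked-prefix (_ ∷ y ∷ ys)  (r ∷ l) = r ∷ linked-prefix (y ∷ ys) l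

-- Entries two apart differ, so no edge is retraced at once. For a closed walk listed with its base
-- point at both ends, the turn at the base point is unrestricted.
NonBacktracking : {A : Set} → List A → Set
NonBacktracking (x ∷ ys@(_ ∷ z ∷ _)) = x ≢ z × NonBacktracking ys
NonBacktracking _                    = ⊤

nonBacktracking-tail : ∀ {A : Set} {x : A} xs → NonBacktracking (x ∷ xs) → NonBacktracking xs
nonBacktracking-tail []          _        = tt
nonBacktracking-tail (_ ∷ [])    _        = tt
nonBacktracking-tail (_ ∷ _ ∷ _) (_ , nb) = nb

module _ (G : Graph) where
  open Graph G renaming (sym to symAdj)

  return⇒cycle : ∀ x ys {zs} → Linked Adj (x ∷ ys ++ x ∷ zs) →
    NonBacktracking (x ∷ ys ++ x ∷ zs) → Unique (ys ++ x ∷ zs) → IsCycle G (x ∷ ys)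
  return⇒cycle x ys l nb u = 3≤ ys l nb , unique-rotate ys u , linked-prefix (x ∷ ys) l
    where
    3≤ : ∀ ys {zs} → Linked Adj (x ∷ ys ++ x ∷ zs) → NonBacktracking (x ∷ ys ++ x ∷ zs) →
      3 ≤ length (x ∷ ys)
    -- Irreflexivity excludes a loop, and non-backtracking excludes a step forth and back.
    3≤ []          (a ∷ _) _         = contradiction a (irrefl refl)
    3≤ (_ ∷ [])    _       (x≢x , _) = contradiction refl x≢x
    3≤ (_ ∷ _ ∷ _) _       _         = s≤s (s≤s (s≤s z≤n))

  module _ (girth≥7 : ∀ ℓ → HasCycleOfLength G ℓ → 7 ≤ ℓ) where

    -- The tail is repetition-free by induction, so a recurrence of the head closes a cycle. As one
    -- of at most 7 entries is a repetition, that cycle has length at most 6.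
    short⇒unique : ∀ xs → length xs ≤ 7 → Linked Adj xs → NonBacktracking xs → Unique xs
    short⇒unique []       _  _ _  = []
    short⇒unique (x ∷ xs) le l nb = ¬Any⇒All¬ xs x∉xs ∷ u
      where
      u : Unique xs
      u = short⇒unique xs (≤-trans (n≤1+n _) le) (Linked.tail l) (nonBacktracking-tail xs nb)
      x∉xs : x ∉ xs
      x∉xs x∈xs with ys , zs , refl ← ∈-∃++ x∈xs = <⇒≱ too-short
        (girth≥7 _ (x ∷ ys , return⇒cycle x ys l nb u , refl))
        where
        open ≤-Reasoning
        too-short : suc (length ys) < 7
        too-short = begin
          2 + length ys                  ≤⟨ s≤s (s≤s (m≤m+n _ (length zs))) ⟩
          2 + (length ys + length zs)    ≡⟨ cong suc (+-suc (length ys) _) ⟨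
          1 + (length ys + suc (length zs)) ≡⟨ cong suc (length-++ ys) ⟨
          1 + length (ys ++ x ∷ zs)      ≤⟨ le ⟩
          7 ∎

    -- Refutes unwanted adjacencies by concrete walks: five inner entries and two ends make seven.
    -- `True` has the bound checked by evaluation.
    no-short-closed-walk : ∀ x ys → {True (length ys ≤? 5)} →
      Linked Adj (x ∷ ys ∷ʳ x) → NonBacktracking (x ∷ ys ∷ʳ x) → ⊥
    no-short-closed-walk x ys {short} l nb =
      Unique[x∷xs]⇒x∉xs (short⇒unique _ le l nb) (∈-insert ys)
      where
      le : length (x ∷ ys ∷ʳ x) ≤ 7
      le = s≤s (≤-trans (≤-reflexive (trans (length-++ ys) (+-comm (length ys) 1)))
                 (s≤s (toWitness short)))

  -- Greedy extension of partial colorings.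

  ProperOn : ∀ {k} → Pred V 0ℓ → (V → Fin k) → Set
  ProperOn D c = ∀ {x y} → D x → D y → Adj x y → c x ≢ c y

  free-color : ∀ {k} {Q : Pred V 0ℓ} (Q? : Decidable Q) (c : V → Fin k) → count Q? < k →
    ∃[ a ] (∀ {y} → Q y → c y ≢ a)
  free-color {Q = Q} Q? c few
    with a , a∉ ← ∃∉ (map c (filter Q? (allFin order)))
                     (subst (_< _) (sym (length-map c (filter Q? (allFin order)))) few) =
    a , λ {y} Qy cy≡a → a∉ (subst (_∈ _) cy≡a (∈-map⁺ c (∈-filter⁺ Q? (∈-allFin y) Qy)))

  module _ {k} {D P : Pred V 0ℓ} (D? : Decidable D) (P? : Decidable P)
    (few : ∀ z → ¬ D z → P z → count (λ y → adj? z y ×-dec (D? ∪? P?) y) < k) where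

    -- At the turn of `z`, its colored neighbours all lie in `D ∪ P`, so by `few` a color is free,
    -- whatever the order within `P`.
    greedy : (c : V → Fin k) → ProperOn D c →
      ∃[ c′ ] (∀ {x} → D x → c′ x ≡ c x) × ProperOn (D ∪ P) c′
    greedy c proper =
      let c′ , agrees , proper′ = color-list (filter P? (allFin order))
                                    (proj₂ ∘ ∈-filter⁻ P? {xs = allFin order})
      in c′ , agrees , λ Dx Dy → proper′ (listed Dx) (listed Dy)
      where
      listed : ∀ {x} → (D ∪ P) x → D x ⊎ x ∈ filter P? (allFin order)
      listed {x} = Sum.map₂ (∈-filter⁺ P? (∈-allFin x))

      color-list : (zs : List V) → (∀ {z} → z ∈ zs → P z) →
        ∃[ c′ ] (∀ {x} → D x → c′ x ≡ c x) × ProperOn (λ x → D x ⊎ x ∈ zs) c′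
      color-list [] _ = c , (λ _ → refl) , λ { (inj₁ Dx) (inj₁ Dy) → proper Dx Dy }
      color-list (z ∷ zs) zs⊆P with color-list zs (zs⊆P ∘ there) | D? z
      ... | c₁ , agrees , proper₁ | yes Dz =
        c₁ , agrees , λ Dx Dy → proper₁ (drop Dx) (drop Dy)
        where
        drop : ∀ {x} → D x ⊎ x ∈ z ∷ zs → D x ⊎ x ∈ zs
        drop (inj₁ Dx)           = inj₁ Dx
        drop (inj₂ (here refl))  = inj₁ Dz
        drop (inj₂ (there x∈zs)) = inj₂ x∈zs
      -- The new color avoids `c₁` at all neighbours in `D ∪ P`, even those still to come, so no
      -- record of the colored ones is needed.
      ... | c₁ , agrees , proper₁ | no ¬Dz
        with a , a-free ← free-color (λ y → adj? z y ×-dec (D? ∪? P?) y) c₁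
                            (few z ¬Dz (zs⊆P (here refl))) =
        c₂ , agrees₂ , proper₂
        where
        c₂ : V → Fin k
        c₂ x with x ≟ z
        ... | yes _ = a
        ... | no  _ = c₁ x

        agrees₂ : ∀ {x} → D x → c₂ x ≡ c x
        agrees₂ {x} Dx with x ≟ z
        ... | yes refl = contradiction Dx ¬Dz
        ... | no  _    = agrees Dx

        in-D∪P : ∀ {x} → D x ⊎ x ∈ z ∷ zs → (D ∪ P) x
        in-D∪P = Sum.map₂ zs⊆P

        drop : ∀ {x} → x ≢ z → D x ⊎ x ∈ z ∷ zs → D x ⊎ x ∈ zs
        drop x≢z (inj₁ Dx)           = inj₁ Dx
        drop x≢z (inj₂ (here x≡z))   = contradiction x≡z x≢z
        drop x≢z (inj₂ (there x∈zs)) = inj₂ x∈zs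

        proper₂ : ProperOn (λ x → D x ⊎ x ∈ z ∷ zs) c₂
        proper₂ {x} {y} Dx Dy xy eq with x ≟ z | y ≟ z
        ... | yes refl | yes refl = irrefl refl xy
        ... | yes refl | no  _    = a-free (xy , in-D∪P Dy) (sym eq)
        ... | no  _    | yes refl = a-free (symAdj xy , in-D∪P Dx) eq
        ... | no  x≢z  | no  y≢z  = proper₁ (drop x≢z Dx) (drop y≢z Dy) xy eq

  -- Skeletons and their precoloring.

  -- As x i j is to get the color of w j, the neighbour x i i is not wanted and
  -- is set to v.
  record Skeleton (m : ℕ) : Set where
    field
      v     : V
      w     : Fin m → V
      x     : Fin m → Fin m → V
      vw    : ∀ i → Adj v (w i)
      w-inj : Injective _≡_ _≡_ w
      wx    : ∀ i j → Adj (w i) (x i j)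
      x-inj : ∀ i → Injective _≡_ _≡_ (x i)
      xᵢᵢ   : ∀ i → x i i ≡ v

    -- The condition on leaves discards the placeholders `x i i`; by `xᵢᵢ` and `x-inj` it amounts to
    -- `i ≢ j`.
    data Node : V → Set where
      root  : Node v
      child : ∀ i → Node (w i)
      leaf  : ∀ i j → v ≢ x i j → Node (x i j)

    node? : Decidable Node
    node? y with v ≟ y
    ... | yes refl = yes root
    ... | no v≢y with any? (λ i → w i ≟ y) | any? (λ i → any? (λ j → x i j ≟ y))
    ... | yes (i , refl) | _                  = yes (child i)
    ... | no _           | yes (i , j , refl) = yes (leaf i j v≢y)
    ... | no y∉w         | no y∉x             = no λ
      { root         → v≢y refl
      ; (child i)    → y∉w (i , refl)
      ; (leaf i j _) → y∉x (i , j , refl)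
      }

    -- The root sees every nonzero color on the children; child `i` sees color zero at the root and
    -- `suc j`, for `j ≢ i`, on its leaves.
    label : ∀ {y} → Node y → Fin (suc m)
    label root         = zero
    label (child i)    = suc i
    label (leaf i j _) = suc j

    module _ (girth≥7 : ∀ ℓ → HasCycleOfLength G ℓ → 7 ≤ ℓ) where

      private
        closed : ∀ x ys → {True (length ys ≤? 5)} →
          Linked Adj (x ∷ ys ∷ʳ x) → NonBacktracking (x ∷ ys ∷ʳ x) → ⊥
        closed x ys {short} = no-short-closed-walk girth≥7 x ys {short}

        wv : ∀ i → Adj (w i) v
        wv i = symAdj (vw i)

        xw : ∀ i j → Adj (x i j) (w i)
        xw i j = symAdj (wx i j)

        v≢w : ∀ i → v ≢ w i
        v≢w i v≡w = irrefl v≡w (vw i)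

        ¬vx : ∀ i j → ¬ Adj v (x i j)
        ¬vx i j a = closed v (w i ∷ x i j ∷ [])
          (vw i ∷ wx i j ∷ symAdj a ∷ [-]) ((λ eq → irrefl eq a) , v≢w i ∘ sym , tt)

        ¬ww : ∀ i i′ → ¬ Adj (w i) (w i′)
        ¬ww i i′ a = closed v (w i ∷ w i′ ∷ [])
          (vw i ∷ a ∷ wv i′ ∷ [-]) (v≢w i′ , v≢w i ∘ sym , tt)

        w≢x : ∀ i i′ j → w i ≢ x i′ j
        w≢x i i′ j eq = ¬ww i′ i (subst (Adj (w i′)) (sym eq) (wx i′ j))

      -- The color depends on the vertex only: a leaf shared by two children would close a 4-cycle
      -- through the root.
      label-unique : ∀ {y y′} (p : Node y) (q : Node y′) → y ≡ y′ → label p ≡ label q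
      label-unique root root _ = refl
      label-unique root (child i) eq = contradiction eq (v≢w i)
      label-unique root (leaf _ _ v≢) eq = contradiction eq v≢
      label-unique (child i) root eq = contradiction (sym eq) (v≢w i)
      label-unique (child i) (child i′) eq = cong suc (w-inj eq)
      label-unique (child i) (leaf i′ j _) eq = contradiction eq (w≢x i i′ j)
      label-unique (leaf _ _ v≢) root eq = contradiction (sym eq) v≢
      label-unique (leaf i j _) (child i′) eq = contradiction (sym eq) (w≢x i′ i j)
      label-unique (leaf i j v≢) (leaf i′ j′ _) eq with i ≟ i′
      ... | yes refl = cong suc (x-inj i eq)
      ... | no i≢i′  = ⊥-elim (closed v (w i ∷ x i j ∷ w i′ ∷ [])
        (vw i ∷ wx i j ∷ subst (λ y → Adj y (w i′)) (sym eq) (xw i′ j′) ∷ wv i′ ∷ [-])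
        (v≢ , i≢i′ ∘ w-inj , v≢ ∘ sym , tt))

      ¬wx : ∀ i i′ j → i ≢ i′ → v ≢ x i′ j → ¬ Adj (w i) (x i′ j)
      ¬wx i i′ j i≢i′ v≢ a = closed v (w i ∷ x i′ j ∷ w i′ ∷ [])
        (vw i ∷ a ∷ xw i′ j ∷ wv i′ ∷ [-]) (v≢ , i≢i′ ∘ w-inj , v≢ ∘ sym , tt)

      -- Below child `i` itself such a leaf would be the placeholder; below another child the edge
      -- would close a 4-cycle.
      ¬wx-monochromatic : ∀ i i′ j → v ≢ x i′ j → i ≡ j → ¬ Adj (w i) (x i′ j)
      ¬wx-monochromatic i i′ .i v≢ refl with i ≟ i′
      ... | yes refl = contradiction (sym (xᵢᵢ i)) v≢
      ... | no i≢i′  = ¬wx i i′ i i≢i′ v≢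

      -- Tree edges join different colors by the choice of labels; any other edge between nodes
      -- would close a cycle of length at most 5.
      label-proper : ∀ {y y′} (p : Node y) (q : Node y′) → Adj y y′ → label p ≢ label q
      label-proper root root a _ = irrefl refl a
      label-proper root (child _) _ ()
      label-proper root (leaf i j _) a _ = ¬vx i j a
      label-proper (child _) root _ ()
      label-proper (child i) (child i′) a _ = ¬ww i i′ a
      label-proper (child i) (leaf i′ j v≢) a eq =
        ¬wx-monochromatic i i′ j v≢ (suc-injective eq) a
      label-proper (leaf i j _) root a _ = ¬vx i j (symAdj a)
      label-proper (leaf i j v≢) (child i′) a eq =
        ¬wx-monochromatic i′ i j v≢ (sym (suc-injective eq)) (symAdj a)
      label-proper (leaf i j v≢) (leaf i′ j′ v≢′) a _ =
        -- No turn of this walk compares `w i` with `w i′`, so leaves below the same child are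
        -- covered too.
        closed v (w i ∷ x i j ∷ x i′ j′ ∷ w i′ ∷ [])
          (vw i ∷ wx i j ∷ a ∷ xw i′ j′ ∷ wv i′ ∷ [-])
          (v≢ , w≢x i i′ j′ , w≢x i′ i j ∘ sym , v≢′ ∘ sym , tt)

      module _ {z} (z∉ : ¬ Node z) where

        private
          v≢z : v ≢ z
          v≢z refl = z∉ root

          w≢z : ∀ i → w i ≢ z
          w≢z i refl = z∉ (child i)

        -- Two nodes are at most four tree edges apart, so a path through `z` would close a cycle of
        -- length at most 6. Leaves below different children attain 6 and use the girth bound in
        -- full.
        ¬two-neighbours : ∀ {y y′} → Node y → Node y′ → y ≢ y′ → Adj y z → ¬ Adj z y′
        ¬two-neighbours root root ≢ _ _ = ≢ refl
        ¬two-neighbours root (child i) ≢ a b =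
          closed v (z ∷ w i ∷ []) (a ∷ b ∷ wv i ∷ [-]) (≢ , v≢z ∘ sym , tt)
        ¬two-neighbours root (leaf i j _) ≢ a b =
          closed v (z ∷ x i j ∷ w i ∷ []) (a ∷ b ∷ xw i j ∷ wv i ∷ [-])
            (≢ , w≢z i ∘ sym , ≢ ∘ sym , tt)
        ¬two-neighbours (child i) root ≢ a b =
          closed v (w i ∷ z ∷ []) (vw i ∷ a ∷ b ∷ [-]) (v≢z , ≢ , tt)
        ¬two-neighbours (child i) (child i′) ≢ a b =
          closed v (w i ∷ z ∷ w i′ ∷ []) (vw i ∷ a ∷ b ∷ wv i′ ∷ [-]) (v≢z , ≢ , v≢z ∘ sym , tt)
        ¬two-neighbours (child i) (leaf i′ j′ v≢′) ≢ a b =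
          closed v (w i ∷ z ∷ x i′ j′ ∷ w i′ ∷ []) (vw i ∷ a ∷ b ∷ xw i′ j′ ∷ wv i′ ∷ [-])
            (v≢z , ≢ , w≢z i′ ∘ sym , v≢′ ∘ sym , tt)
        ¬two-neighbours (leaf i j _) root ≢ a b =
          closed v (w i ∷ x i j ∷ z ∷ []) (vw i ∷ wx i j ∷ a ∷ b ∷ [-])
            (≢ ∘ sym , w≢z i , ≢ , tt)
        ¬two-neighbours (leaf i j v≢) (child i′) ≢ a b =
          closed v (w i ∷ x i j ∷ z ∷ w i′ ∷ []) (vw i ∷ wx i j ∷ a ∷ b ∷ wv i′ ∷ [-])
            (v≢ , w≢z i , ≢ , v≢z ∘ sym , tt)
        ¬two-neighbours (leaf i j v≢) (leaf i′ j′ v≢′) ≢ a b =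
          closed v (w i ∷ x i j ∷ z ∷ x i′ j′ ∷ w i′ ∷ [])
            (vw i ∷ wx i j ∷ a ∷ b ∷ xw i′ j′ ∷ wv i′ ∷ [-])
            (v≢ , w≢z i , ≢ , w≢z i′ ∘ sym , v≢′ ∘ sym , tt)

        neighbours-in-skeleton≤1 : count (λ y → adj? z y ×-dec node? y) ≤ 1
        neighbours-in-skeleton≤1 = count≤1 (λ y → adj? z y ×-dec node? y)
          λ {y} {y′} (zy , p) (zy′ , q) → decidable-stable (y ≟ y′)
            λ y≢y′ → ¬two-neighbours p q y≢y′ (symAdj zy) zy′

      precoloring : V → Fin (suc m)
      precoloring y with node? y
      ... | yes p = label p
      -- An arbitrary default: properness is claimed on nodes only.
      ... | no  _ = zero

      precoloring-label : ∀ {y} (p : Node y) → precoloring y ≡ label p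
      precoloring-label {y} p with node? y
      ... | yes q = label-unique q p refl
      ... | no ¬p = contradiction p ¬p

      precoloring-proper : ProperOn Node precoloring
      precoloring-proper p q a eq = label-proper p q a
        (trans (sym (precoloring-label p)) (trans eq (precoloring-label q)))

      extends-precoloring⇒b⋆ : (c : V → Fin (suc m)) → ProperOn U c →
        (∀ {y} → Node y → c y ≡ precoloring y) → HasB⋆Coloring G (suc m)
      extends-precoloring⇒b⋆ c proper agrees = coloring , v , nice
        where
        c-label : ∀ {y} (p : Node y) → c y ≡ label p
        c-label p = trans (agrees p) (precoloring-label p)

        coloring : ProperColoring G (suc m)
        coloring = record
          { color      = c
          ; surjective = λ { zero → v , c-label root ; (suc i) → w i , c-label (child i) }
          ; proper     = proper tt tt
          }

        open ProperColoring coloring using (IsNice; IsBVertex)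

        child-b : ∀ i → IsBVertex (w i)
        child-b i zero _ = v , wv i , c-label root
        -- As `suc j` is not the color of `w i`, `j` differs from `i`, and `x i j` is a genuine
        -- leaf.
        child-b i (suc j) ≢ = x i j , wx i j , c-label (leaf i j λ v≡x →
          ≢ (trans (cong suc (x-inj i (trans (sym v≡x) (sym (xᵢᵢ i))))) (sym (c-label (child i)))))

        nice : IsNice v
        nice zero    ≢ = contradiction (sym (c-label root)) ≢
        nice (suc i) _ = w i , vw i , c-label (child i) , child-b i

  -- Existence of m⋆ and the upper bound on b⋆.

  M⋆Condition? : ∀ k → Dec (M⋆Condition G k)
  M⋆Condition? k = any? λ v →
    (k ≤? degree G v) ×-dec (k ≤? count (λ w → adj? v w ×-dec (k ≤? degree G w)))

  m⋆-exists : ∃ (IsM⋆ G)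
  m⋆-exists = bounded⇒maximum M⋆Condition? (vertex order {{nonZero}} , z≤n , z≤n) order
    λ { k (v , k≤ , _) → ≤-trans k≤ (count≤n (adj? v)) }
    where
    vertex : ∀ n → {{NonZero n}} → Fin n
    vertex (suc n) = zero

  -- Neighbours chosen for the `k` other colors are distinct, so a b-vertex has degree at least `k`.
  -- The nice vertex is itself a b-vertex, and so are its chosen neighbours.
  coloring⇒M⋆Condition : ∀ {k} → HasB⋆Coloring G (suc k) → M⋆Condition G k
  coloring⇒M⋆Condition {k} (coloring , u , nice) =
    u , b-vertex⇒degree (λ j ≢ → let w , uw , cw , _ = nice j ≢ in w , uw , cw) ,
    injective⇒≤count (λ w → adj? u w ×-dec (k ≤? degree G w))
      (section-injective nice) (λ i →
        let w , uw , _ , w-b = nice _ (punchInᵢ≢i (color u) i) in uw , b-vertex⇒degree w-b)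
    where
    open ProperColoring coloring

    section-injective : ∀ {u} {B : ∀ w → Fin (suc k) → Set}
      (f : ∀ j → j ≢ color u → ∃[ w ] Adj u w × color w ≡ j × B w j) →
      Injective _≡_ _≡_ (λ i → proj₁ (f _ (punchInᵢ≢i (color u) i)))
    section-injective {u} f {i} {j} eq = punchIn-injective (color u) i j
      (trans (sym (color-f i)) (trans (cong color eq) (color-f j)))
      where
      color-f : ∀ i → color (proj₁ (f _ (punchInᵢ≢i (color u) i))) ≡ punchIn (color u) i
      color-f i = proj₁ (proj₂ (proj₂ (f _ (punchInᵢ≢i (color u) i))))

    b-vertex⇒degree : ∀ {u} → IsBVertex u → k ≤ degree G u
    b-vertex⇒degree {u} u-b = injective⇒≤count (adj? u)
      (section-injective {B = λ _ _ → ⊤} λ j ≢ → let w , uw , cw = u-b j ≢ in w , uw , cw , tt)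
      (λ i → proj₁ (proj₂ (u-b _ (punchInᵢ≢i (color u) i))))

  -- The lower bound: heavy and saturated vertices.

  module _ (girth≥7 : ∀ ℓ → HasCycleOfLength G ℓ → 7 ≤ ℓ) {m} (m⋆ : IsM⋆ G m) where

    private
      Heavy : Pred V 0ℓ
      Heavy y = m < degree G y

      heavy? : Decidable Heavy
      heavy? y = suc m ≤? degree G y

      heavyNeighbour? : ∀ z → Decidable (λ y → Adj z y × Heavy y)
      heavyNeighbour? z y = adj? z y ×-dec heavy? y

      Saturated : Pred V 0ℓ
      Saturated z = Heavy z × m ≤ count (heavyNeighbour? z)

      saturated? : Decidable Saturated
      saturated? z = heavy? z ×-dec (m ≤? count (heavyNeighbour? z))

      UnsaturatedHeavyNeighbour : V → Pred V 0ℓ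
      UnsaturatedHeavyNeighbour z y = (Adj z y × Heavy y) × ¬ Saturated y

      unsaturatedHeavyNeighbour? : ∀ z → Decidable (UnsaturatedHeavyNeighbour z)
      unsaturatedHeavyNeighbour? z y = heavyNeighbour? z y ×-dec ¬? (saturated? y)

    -- With more than `m` heavy neighbours, `z` would itself have degree above `m` and so witness
    -- `M⋆Condition (suc m)`.
    heavyNeighbours≤m : ∀ z → count (heavyNeighbour? z) ≤ m
    heavyNeighbours≤m z = ≮⇒≥ λ m<count → <⇒≱ ≤-refl (proj₂ m⋆ (suc m)
      (z , ≤-trans m<count (count-mono (heavyNeighbour? z) (adj? z) proj₁) , m<count))

    module _ (S : Skeleton m) where
      open Skeleton S

      -- The hypotheses serve the first two greedy rounds; a vertex left for the third is not heavy,
      -- so it has at most `m` neighbours in all.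
      extend-precoloring :
        (∀ z → ¬ Node z → Saturated z →
          count (λ y → adj? z y ×-dec (node? ∪? saturated?) y) ≤ m) →
        (∀ z → ¬ Node z → ¬ Saturated z → Heavy z →
          count (λ y → adj? z y ×-dec (node? ∪? heavy?) y) ≤ m) →
        HasB⋆Coloring G (suc m)
      extend-precoloring few-saturated few-heavy =
        let c₁ , agrees₁ , proper₁ = greedy node? saturated?
              (λ z z∉ z-sat → s≤s (few-saturated z z∉ z-sat))
              (precoloring girth≥7) (precoloring-proper girth≥7)
            c₂ , agrees₂ , proper₂ = greedy (node? ∪? saturated?) heavy?
              (λ z z∉ z-heavy → s≤s (≤-trans
                -- Saturated vertices are heavy, so they need no separate count in the second round.
                (count-mono _ (λ y → adj? z y ×-dec (node? ∪? heavy?) y)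
                  λ { (zy , inj₁ (inj₁ p))           → zy , inj₁ p
                    ; (zy , inj₁ (inj₂ (y-heavy , _))) → zy , inj₂ y-heavy
                    ; (zy , inj₂ y-heavy)            → zy , inj₂ y-heavy })
                (few-heavy z (z∉ ∘ inj₁) (z∉ ∘ inj₂) z-heavy)))
              c₁ proper₁
            c₃ , agrees₃ , proper₃ = greedy ((node? ∪? saturated?) ∪? heavy?) U?
              (λ z z∉ _ → s≤s (≤-trans (count-mono _ (adj? z) proj₁) (≮⇒≥ (z∉ ∘ inj₂))))
              c₂ proper₂
        in extends-precoloring⇒b⋆ girth≥7 c₃ (λ _ _ → proper₃ (inj₂ tt) (inj₂ tt))
             λ p → trans (agrees₃ (inj₁ (inj₁ p))) (trans (agrees₂ (inj₁ p)) (agrees₁ p))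

    -- All nodes can be chosen heavy, the leaves among the heavy neighbours of the saturated `w i`.
    -- Both rounds then count heavy neighbours only.
    b⋆-of-saturated-cluster : ∀ v → Saturated v → ¬ ∃ (UnsaturatedHeavyNeighbour v) →
      HasB⋆Coloring G (suc m)
    b⋆-of-saturated-cluster v (v-heavy , m≤) all-saturated
      with w , w-inj , w-nbr ← enumerate (heavyNeighbour? v) m≤ =
      extend-precoloring S
        (λ z _ _ → ≤-trans (count-mono _ (heavyNeighbour? z)
          λ { (zy , inj₁ p)             → zy , node-heavy p
            ; (zy , inj₂ (y-heavy , _)) → zy , y-heavy })
          (heavyNeighbours≤m z))
        (λ z _ _ _ → ≤-trans (count-mono _ (heavyNeighbour? z)
          λ { (zy , inj₁ p)       → zy , node-heavy p
            ; (zy , inj₂ y-heavy) → zy , y-heavy })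
          (heavyNeighbours≤m z))
      where
      w-saturated : ∀ i → Saturated (w i)
      w-saturated i = decidable-stable (saturated? (w i)) λ unsat →
        all-saturated (w i , w-nbr i , unsat)

      x-spec : ∀ i → ∃[ f ] Injective _≡_ _≡_ f × (∀ j → Adj (w i) (f j) × Heavy (f j)) × f i ≡ v
      -- The root is heavy, so it can stand at index `i` among the heavy neighbours of `w i`.
      x-spec i = enumerate-through (heavyNeighbour? (w i)) (proj₂ (w-saturated i))
        (symAdj (proj₁ (w-nbr i)) , v-heavy) i

      S : Skeleton m
      S = record
        { v = v ; w = w ; x = λ i → proj₁ (x-spec i)
        ; vw    = λ i → proj₁ (w-nbr i)
        ; w-inj = w-inj
        ; wx    = λ i j → proj₁ (proj₁ (proj₂ (proj₂ (x-spec i))) j)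
        ; x-inj = λ i → proj₁ (proj₂ (x-spec i))
        ; xᵢᵢ   = λ i → proj₂ (proj₂ (proj₂ (x-spec i)))
        }

      node-heavy : Skeleton.Node S ⊆ Heavy
      node-heavy Skeleton.root         = v-heavy
      node-heavy (Skeleton.child i)    = proj₂ (w-nbr i)
      node-heavy (Skeleton.leaf i j _) = proj₂ (proj₁ (proj₂ (proj₂ (x-spec i))) j)

    -- The skeleton comes from the witness of `M⋆Condition G m`. As a vertex outside sees at most
    -- one node, fewer than `m` saturated or heavy neighbours, respectively, suffice in the two
    -- rounds.
    b⋆-of-no-saturated-cluster : (∀ z → Saturated z → ∃ (UnsaturatedHeavyNeighbour z)) →
      HasB⋆Coloring G (suc m)
    b⋆-of-no-saturated-cluster has-unsaturated
      with v , _ , m≤ ← proj₁ m⋆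
      with w , w-inj , w-nbr ← enumerate (λ w → adj? v w ×-dec (m ≤? degree G w)) m≤ =
      extend-precoloring S
        (λ z z∉ z-sat → at-most-one-more z z∉ saturated? (few-saturated z z-sat))
        (λ z z∉ unsat z-heavy → at-most-one-more z z∉ heavy?
          (≰⇒> λ m≤ → unsat (z-heavy , m≤)))
      where
      x-spec : ∀ i → ∃[ f ] Injective _≡_ _≡_ f × (∀ j → Adj (w i) (f j)) × f i ≡ v
      x-spec i = enumerate-through (adj? (w i)) (proj₂ (w-nbr i)) (symAdj (proj₁ (w-nbr i))) i

      S : Skeleton m
      S = record
        { v = v ; w = w ; x = λ i → proj₁ (x-spec i)
        ; vw    = λ i → proj₁ (w-nbr i)
        ; w-inj = w-inj
        ; wx    = λ i → proj₁ (proj₂ (proj₂ (x-spec i)))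
        ; x-inj = λ i → proj₁ (proj₂ (x-spec i))
        ; xᵢᵢ   = λ i → proj₂ (proj₂ (proj₂ (x-spec i)))
        }

      open Skeleton S using (Node; node?; neighbours-in-skeleton≤1)

      at-most-one-more : ∀ z → ¬ Node z → {Q : Pred V 0ℓ} (Q? : Decidable Q) →
        count (λ y → adj? z y ×-dec Q? y) < m →
        count (λ y → adj? z y ×-dec (node? ∪? Q?) y) ≤ m
      at-most-one-more z z∉ Q? few = begin
        count (λ y → adj? z y ×-dec (node? ∪? Q?) y)
          ≤⟨ count-mono _ (zNode? ∪? zQ?)
               (λ { (zy , inj₁ p) → inj₁ (zy , p) ; (zy , inj₂ q) → inj₂ (zy , q) }) ⟩
        count (zNode? ∪? zQ?)
          ≤⟨ length-filter-∪ zNode? zQ? (allFin order) ⟩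
        count zNode? + count zQ?
          ≤⟨ +-mono-≤ (neighbours-in-skeleton≤1 girth≥7 z∉) ≤-refl ⟩
        1 + count zQ?
          ≤⟨ few ⟩
        m ∎
        where
        open ≤-Reasoning
        zNode? = λ y → adj? z y ×-dec node? y
        zQ?    = λ y → adj? z y ×-dec Q? y

      -- An unsaturated heavy neighbour makes the saturated neighbours a proper subset of the at
      -- most `m` heavy ones.
      few-saturated : ∀ z → Saturated z → count (λ y → adj? z y ×-dec saturated? y) < m
      few-saturated z z-sat with y , zy , unsat ← has-unsaturated z z-sat = ≤-trans
        (count-mono-< _ (heavyNeighbour? z) (λ (zy , y-heavy , _) → zy , y-heavy)
          zy (λ (_ , sat) → unsat sat))
        (heavyNeighbours≤m z)

    b⋆-coloring : HasB⋆Coloring G (suc m)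
    b⋆-coloring with any? (λ v → saturated? v ×-dec ¬? (any? (unsaturatedHeavyNeighbour? v)))
    ... | yes (v , v-sat , all-saturated) = b⋆-of-saturated-cluster v v-sat all-saturated
    ... | no ¬cluster = b⋆-of-no-saturated-cluster λ z z-sat →
      decidable-stable (any? (unsaturatedHeavyNeighbour? z)) λ none → ¬cluster (z , z-sat , none)

    b⋆≡m⋆+1 : IsB⋆ G (suc m)
    b⋆≡m⋆+1 = b⋆-coloring , λ
      { zero    _ → z≤n
      ; (suc k) c → s≤s (proj₂ m⋆ k (coloring⇒M⋆Condition c)) }

  girth⇒cycles-long : ∀ {n} g → IsGirth G g → [ n ] ≤⁺ g → ∀ ℓ → HasCycleOfLength G ℓ → n ≤ ℓ
  girth⇒cycles-long [ g ] (_ , minimal) [ n≤g ]  ℓ cyc = ≤-trans n≤g (minimal ℓ cyc)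
  girth⇒cycles-long ⊤⁺    acyclic       (_ ≤⊤⁺) ℓ cyc = contradiction cyc (acyclic ℓ)

theorem1 : (G : Graph) (g : ℕ ⁺) → IsGirth G g → [ 7 ] ≤⁺ g →
    ∃[ b ] ∃[ m ] IsB⋆ G b × IsM⋆ G m × b ≡ m + 1
theorem1 G g g-girth 7≤g with m , m⋆ ← m⋆-exists G =
  suc m , m , b⋆≡m⋆+1 G (girth⇒cycles-long G g g-girth 7≤g) m⋆ , m⋆ , +-comm 1 m
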